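{- Let $\mathcal{C}$ be a nondegenerate $[n,3]_{q^m/q}$ code with $n\ge m+2$ and let $\mathcal{U}$ be any $[n,3]_{q^m/q}$ system corresponding to $\mathcal{C}$. If the linear set $L_{\mathcal{U}}$ is scattered, then $\mathcal{C}$ is a minimal rank-metric code.
   Context: Let $q$ be a prime power and $n,m,k$ positive integers. For $v\in\mathbb{F}_{q^m}^n$ and an ordered basis $\Gamma=(\gamma_1,\dots,\gamma_m)$ of $\mathbb{F}_{q^m}$ over $\mathbb{F}_q$, let $\Gamma(v)\in\mathbb{F}_q^{n\times m}$ be the matrix with $v_i=\sum_{j}\Gamma(v)_{ij}\gamma_j$. The rank support $\sigma^{\mathrm{rk}}(v)\subseteq\mathbb{F}_q^n$ is the column space of $\Gamma(v)$ (independent of $\Gamma$). An $[n,k]_{q^m/q}$ code is a $k$-dimensional $\mathbb{F}_{q^m}$-subspace $\mathcal{C}\subseteq\mathbb{F}_{q^m}^n$; it is nondegenerate if $\sum_{v\in\mathcal{C}}\sigma^{\mathrm{rk}}(v)=\mathbb{F}_q^n$, and minimal if for all $v,v'\in\mathcal{C}$, $\sigma^{\mathrm{rk}}(v')\subseteq\sigma^{\mathrm{rk}}(v)$ implies $v'=\alpha v$ for some $\alpha\in\mathbb{F}_{q^m}$. An $[n,k]_{q^m/q}$ system is an $n$-dimensional $\mathbb{F}_q$-subspace $\mathcal{U}\subseteq\mathbb{F}_{q^m}^k$ with $\langle\mathcal{U}\rangle_{\mathbb{F}_{q^m}}=\mathbb{F}_{q^m}^k$. A system corresponding to a nondegenerate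 code $\mathcal{C}$ is the $\mathbb{F}_q$-span of the columns of a generator matrix $G\in\mathbb{F}_{q^m}^{k\times n}$ of $\mathcal{C}$. The linear set of $\mathcal{U}$ is $L_{\mathcal{U}}=\{\langle u\rangle_{\mathbb{F}_{q^m}}:u\in\mathcal{U}\setminus\{0\}\}\subseteq\mathrm{PG}(k-1,q^m)$. It always satisfies $|L_{\mathcal{U}}|\le\frac{q^n-1}{q-1}$ and is called scattered if equality holds, equivalently if $\dim_{\mathbb{F}_q}(\mathcal{U}\cap P)=1$ for every $P\in L_{\mathcal{U}}$ (viewing $P$ as a $1$-dimensional $\mathbb{F}_{q^m}$-subspace). -}

module Defs where

open import Level using (Level; _⊔_; suc)
open import Data.Nat.Base using (ℕ; _+_; _*_; _∸_; _^_)
open import Data.Nat.Primality using (Prime)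
open import Data.Fin.Base using (Fin)
open import Data.Product.Base using (Σ-syntax; ∃; ∃-syntax; _×_; _,_; proj₁; proj₂)
open import Data.Vec.Functional using (Vector; transpose)
open import Function.Bundles using (Inverse)
open import Relation.Binary.Bundles using (Setoid)
open import Relation.Binary.PropositionalEquality as ≡ using (_≡_)
open import Relation.Nullary.Negation using (¬_)
open import Relation.Unary using (Pred; _∈_; _⊆_; _≐_; U)
open import Relation.Unary.Properties using (≐-refl; ≐-sym; ≐-trans)
open import Algebra.Apartness.Bundles using (HeytingField; HeytingCommutativeRing)
open import Algebra.Bundles using (Ring; CommutativeRing)
open import Algebra.Definitions.RawMonoid using (sum)
open import Algebra.Module.Bundles using (LeftModule)
import Algebra.Module.Construct.TensorUnit as TensorUnit
open import Algebra.Morphism.Structures using (module RingMorphisms)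

PrimePower : ℕ → Set
PrimePower q = ∃[ p ] ∃[ e ] Prime p × q ≡ p ^ (1 + e)

HasCardinality : ∀ {a ℓ} → Setoid a ℓ → ℕ → Set (a ⊔ ℓ)
HasCardinality S N = Inverse S (≡.setoid (Fin N))

-- Subspaces are predicates; a "vector space" is a left module, the
-- coefficient ring being a field in every use below.
module LinearAlgebra {r ℓr m ℓm : Level} {R : Ring r ℓr} (M : LeftModule R m ℓm) where
  open Ring R using (Carrier; _≈_; 0#)
  open LeftModule M

  lincomb : ∀ {d} → Vector Carrier d → Vector Carrierᴹ d → Carrierᴹ
  lincomb a b = sum +ᴹ-rawMonoid (λ i → a i *ₗ b i)

  Span : ∀ {d} → Vector Carrierᴹ d → Pred Carrierᴹ (r ⊔ ℓm)
  Span b x = ∃[ a ] x ≈ᴹ lincomb a b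

  SpanOf : ∀ {p} → Pred Carrierᴹ p → Pred Carrierᴹ (r ⊔ m ⊔ ℓm ⊔ p)
  SpanOf P x = ∃[ d ] Σ[ b ∈ Vector Carrierᴹ d ] (∀ i → b i ∈ P) × x ∈ Span b

  record IsSubspace {p} (P : Pred Carrierᴹ p) : Set (r ⊔ m ⊔ ℓm ⊔ p) where
    field
      resp      : ∀ {x y} → x ≈ᴹ y → x ∈ P → y ∈ P
      0-closed  : 0ᴹ ∈ P
      +-closed  : ∀ {x y} → x ∈ P → y ∈ P → x +ᴹ y ∈ P
      *ₗ-closed : ∀ a {x} → x ∈ P → a *ₗ x ∈ P

  LinearlyIndependent : ∀ {d} → Vector Carrierᴹ d → Set (r ⊔ ℓr ⊔ ℓm)
  LinearlyIndependent b = ∀ a → lincomb a b ≈ᴹ 0ᴹ → ∀ i → a i ≈ 0#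

  record IsBasis {d p} (b : Vector Carrierᴹ d) (P : Pred Carrierᴹ p)
         : Set (r ⊔ ℓr ⊔ m ⊔ ℓm ⊔ p) where
    field
      members     : ∀ i → b i ∈ P
      independent : LinearlyIndependent b
      spanning    : ∀ {x} → x ∈ P → x ∈ Span b

  HasDimension : ∀ {p} → Pred Carrierᴹ p → ℕ → Set (r ⊔ ℓr ⊔ m ⊔ ℓm ⊔ p)
  HasDimension P d = Σ[ b ∈ Vector Carrierᴹ d ] IsBasis b P

  -- The sum of a possibly infinite family: finite sums of elements, each
  -- taken from some member of the family.
  SumOfSubspaces : ∀ {i p} {I : Set i} → (I → Pred Carrierᴹ p) → Pred Carrierᴹ (i ⊔ m ⊔ ℓm ⊔ p)
  SumOfSubspaces {I = I} W x =
    ∃[ d ] Σ[ w ∈ Vector Carrierᴹ d ]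
      (∀ j → Σ[ i ∈ I ] w j ∈ W i) × x ≈ᴹ sum +ᴹ-rawMonoid w

  SameLine : Carrierᴹ → Carrierᴹ → Set (r ⊔ m ⊔ ℓm)
  SameLine x y = Span {1} (λ _ → x) ≐ Span {1} (λ _ → y)

power : ∀ {r ℓr m ℓm} {R : Ring r ℓr} → LeftModule R m ℓm → ℕ → LeftModule R m ℓm
power M n = record
  { Carrierᴹ = Vector Carrierᴹ n
  ; _≈ᴹ_ = λ x y → ∀ i → x i ≈ᴹ y i
  ; _+ᴹ_ = λ x y i → x i +ᴹ y i
  ; _*ₗ_ = λ a x i → a *ₗ x i
  ; 0ᴹ = λ _ → 0ᴹ
  ; -ᴹ_ = λ x i → -ᴹ x i
  ; isLeftModule = record
    { isLeftSemimodule = record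
      { +ᴹ-isCommutativeMonoid = record
        { isMonoid = record
          { isSemigroup = record
            { isMagma = record
              { isEquivalence = record
                { refl = λ _ → ≈ᴹ-refl
                ; sym = λ p i → ≈ᴹ-sym (p i)
                ; trans = λ p q i → ≈ᴹ-trans (p i) (q i)
                }
              ; ∙-cong = λ p q i → +ᴹ-cong (p i) (q i)
              }
            ; assoc = λ x y z i → +ᴹ-assoc (x i) (y i) (z i)
            }
          ; identity = (λ x i → +ᴹ-identityˡ (x i)) , (λ x i → +ᴹ-identityʳ (x i))
          }
        ; comm = λ x y i → +ᴹ-comm (x i) (y i)
        }
      ; isPreleftSemimodule = record
        { *ₗ-cong = λ p q i → *ₗ-cong p (q i)
        ; *ₗ-zeroˡ = λ x i → *ₗ-zeroˡ (x i)
        ; *ₗ-distribʳ = λ x a b i → *ₗ-distribʳ (x i) a b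
        ; *ₗ-identityˡ = λ x i → *ₗ-identityˡ (x i)
        ; *ₗ-assoc = λ a b x i → *ₗ-assoc a b (x i)
        ; *ₗ-zeroʳ = λ a i → *ₗ-zeroʳ a
        ; *ₗ-distribˡ = λ a x y i → *ₗ-distribˡ a (x i) (y i)
        }
      }
    ; -ᴹ‿cong = λ p i → -ᴹ‿cong (p i)
    ; -ᴹ‿inverse = (λ x i → -ᴹ‿inverseˡ (x i)) , (λ x i → -ᴹ‿inverseʳ (x i))
    }
  } where open LeftModule M

module _ {r ℓr s ℓs : Level} {R : Ring r ℓr} {S : Ring s ℓs} where
  private
    module R = Ring R
    module S = Ring S
  open RingMorphisms R.rawRing S.rawRing using (IsRingMonomorphism)

  restrictScalars : ∀ {m ℓm} {ι : R.Carrier → S.Carrier} → IsRingMonomorphism ι →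
                    LeftModule S m ℓm → LeftModule R m ℓm
  restrictScalars {ι = ι} ι-mono M = record
    { Carrierᴹ = Carrierᴹ
    ; _≈ᴹ_ = _≈ᴹ_
    ; _+ᴹ_ = _+ᴹ_
    ; _*ₗ_ = λ a x → ι a *ₗ x
    ; 0ᴹ = 0ᴹ
    ; -ᴹ_ = -ᴹ_
    ; isLeftModule = record
      { isLeftSemimodule = record
        { +ᴹ-isCommutativeMonoid = +ᴹ-isCommutativeMonoid
        ; isPreleftSemimodule = record
          { *ₗ-cong = λ p q → *ₗ-cong (⟦⟧-cong p) q
          ; *ₗ-zeroˡ = λ x → ≈ᴹ-trans (*ₗ-congʳ 0#-homo) (*ₗ-zeroˡ x)
          ; *ₗ-distribʳ = λ x a b → ≈ᴹ-trans (*ₗ-congʳ (+-homo a b)) (*ₗ-distribʳ x (ι a) (ι b))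
          ; *ₗ-identityˡ = λ x → ≈ᴹ-trans (*ₗ-congʳ 1#-homo) (*ₗ-identityˡ x)
          ; *ₗ-assoc = λ a b x → ≈ᴹ-trans (*ₗ-congʳ (*-homo a b)) (*ₗ-assoc (ι a) (ι b) x)
          ; *ₗ-zeroʳ = λ a → *ₗ-zeroʳ (ι a)
          ; *ₗ-distribˡ = λ a → *ₗ-distribˡ (ι a)
          }
        }
      ; -ᴹ‿cong = -ᴹ‿cong
      ; -ᴹ‿inverse = -ᴹ‿inverse
      }
    }
    where
    open LeftModule M
    open RingMorphisms.IsRingMonomorphism ι-mono

fieldRing : ∀ {c ℓ ℓ#} → HeytingField c ℓ ℓ# → Ring c ℓ
fieldRing F = CommutativeRing.ring
  (HeytingCommutativeRing.commutativeRing (HeytingField.heytingCommutativeRing F))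

-- F_q ⊆ F_{q^m}.  For a finite field the apartness of a Heyting field is
-- necessarily the negation of equality, so this is the classical notion.
record FiniteFieldExtension (c ℓ ℓ# c′ ℓ′ ℓ#′ : Level) (q m : ℕ)
       : Set (suc (c ⊔ ℓ ⊔ ℓ# ⊔ c′ ⊔ ℓ′ ⊔ ℓ#′)) where
  field
    𝔽q  : HeytingField c ℓ ℓ#
    𝔽qᵐ : HeytingField c′ ℓ′ ℓ#′

  K : Ring c ℓ
  K = fieldRing 𝔽q

  L : Ring c′ ℓ′
  L = fieldRing 𝔽qᵐ

  field
    K-cardinality : HasCardinality (Ring.setoid K) q
    L-cardinality : HasCardinality (Ring.setoid L) (q ^ m)
    ι             : Ring.Carrier K → Ring.Carrier L
    ι-mono        : RingMorphisms.IsRingMonomorphism (Ring.rawRing K) (Ring.rawRing L) ι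

module RankMetric {c ℓ ℓ# c′ ℓ′ ℓ#′ : Level} {q m : ℕ}
                  (E : FiniteFieldExtension c ℓ ℓ# c′ ℓ′ ℓ#′ q m) where
  open FiniteFieldExtension E

  K^ : ℕ → LeftModule K c ℓ
  K^ = power TensorUnit.leftModule

  L^ : ℕ → LeftModule L c′ ℓ′
  L^ = power TensorUnit.leftModule

  L/K : LeftModule K c′ ℓ′
  L/K = restrictScalars {R = K} {S = L} ι-mono TensorUnit.leftModule

  L^/K : ℕ → LeftModule K c′ ℓ′
  L^/K k = restrictScalars {R = K} {S = L} ι-mono (L^ k)

  Lvec : ℕ → Set c′
  Lvec n = Vector (Ring.Carrier L) n

  module K^ (n : ℕ) = LinearAlgebra (K^ n)
  module L^ (n : ℕ) = LinearAlgebra (L^ n)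
  module L/K = LinearAlgebra L/K
  module L^/K (n : ℕ) = LinearAlgebra (L^/K n)

  record OrderedBasis : Set (c ⊔ ℓ ⊔ c′ ⊔ ℓ′) where
    field
      γ       : Vector (Ring.Carrier L) m
      isBasis : L/K.IsBasis γ U

  -- Row i consists of the coordinates of v i with respect to Γ.
  expand : ∀ {n} → OrderedBasis → Lvec n → Vector (Vector (Ring.Carrier K) m) n
  expand Γ v i = proj₁ (L/K.IsBasis.spanning (OrderedBasis.isBasis Γ) {v i} _)

  rankSupport : ∀ {n} → OrderedBasis → Lvec n → Pred (Vector (Ring.Carrier K) n) (c ⊔ ℓ)
  rankSupport {n} Γ v = K^.Span n (transpose (expand Γ v))

  record IsCode (n k : ℕ) {p} (C : Pred (Lvec n) p) : Set (c′ ⊔ ℓ′ ⊔ p) where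
    field
      isSubspace : L^.IsSubspace n C
      dimension  : L^.HasDimension n C k

  Nondegenerate : ∀ {n p} → OrderedBasis → Pred (Lvec n) p → Set (c ⊔ ℓ ⊔ c′ ⊔ p)
  Nondegenerate {n} Γ C =
    ∀ x → x ∈ K^.SumOfSubspaces n {I = ∃ C} (λ v → rankSupport Γ (proj₁ v))

  Minimal : ∀ {n p} → OrderedBasis → Pred (Lvec n) p → Set (c ⊔ ℓ ⊔ c′ ⊔ ℓ′ ⊔ p)
  Minimal {n} Γ C =
    ∀ v v′ → v ∈ C → v′ ∈ C → rankSupport Γ v′ ⊆ rankSupport Γ v →
    ∃[ α ] v′ ≈ᴹ α *ₗ v
    where open LeftModule (L^ n)

  record IsSystem (n k : ℕ) {p} (𝒰 : Pred (Lvec k) p) : Set (c ⊔ ℓ ⊔ c′ ⊔ ℓ′ ⊔ p) where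
    field
      isSubspace : L^/K.IsSubspace k 𝒰
      dimension  : L^/K.HasDimension k 𝒰 n
      spanning   : ∀ x → x ∈ L^.SpanOf k 𝒰

  -- G is a k × n matrix given by its rows.
  IsGeneratorMatrix : ∀ {n k p} → Vector (Lvec n) k → Pred (Lvec n) p → Set (c′ ⊔ ℓ′ ⊔ p)
  IsGeneratorMatrix {n} G C = L^.IsBasis n G C

  CorrespondsTo : ∀ {n k p p′} → Pred (Lvec k) p → Pred (Lvec n) p′ → Set (c ⊔ c′ ⊔ ℓ′ ⊔ p ⊔ p′)
  CorrespondsTo {n} {k} 𝒰 C =
    Σ[ G ∈ Vector (Lvec n) k ] IsGeneratorMatrix G C × 𝒰 ≐ L^/K.Span k (transpose G)

  -- The point ⟨u⟩ is represented by u, and two representatives are identified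
  -- when they span the same 1-dimensional F_{q^m}-subspace.
  linearSet : ∀ {k p} → Pred (Lvec k) p → Setoid (c′ ⊔ ℓ′ ⊔ p) (c′ ⊔ ℓ′)
  linearSet {k} 𝒰 = record
    { Carrier = Σ[ u ∈ Lvec k ] u ∈ 𝒰 × ¬ (u ≈ᴹ 0ᴹ)
    ; _≈_ = λ x y → L^.SameLine k (proj₁ x) (proj₁ y)
    ; isEquivalence = record { refl = ≐-refl ; sym = ≐-sym ; trans = ≐-trans }
    }
    where open LeftModule (L^ k)

  -- |L_𝒰| = (q^n − 1)/(q − 1); here q ≥ 2 and the division is exact.
  Scattered : ∀ {k p} → ℕ → Pred (Lvec k) p → Set (c′ ⊔ ℓ′ ⊔ p)
  Scattered n 𝒰 = ∃[ N ] N * (q ∸ 1) ≡ q ^ n ∸ 1 × HasCardinality (linearSet 𝒰) N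

{-# OPTIONS --safe #-}

-- Write y ⟂ v for Σ ι(yᵢ) vᵢ = 0, with y over F_q.  Then σ(v′) ⊆ σ(v) says that
-- v^⟂ ⊆ v′^⟂, and for v = xG we have y ⟂ v iff Gy lies on the line x^⟂ of the plane.
-- If x and x′ are not proportional, then Gy lies on the point x × x′ for every
-- y ⟂ v; but v^⟂ has dimension at least n − m ≥ 2, whereas scatteredness allows
-- only dimension 1 on a point (and y ↦ Gy is injective by nondegeneracy).
module Submission where

open import Defs
open import Level using (Level)
open import Algebra.Apartness.Bundles using (HeytingField; HeytingCommutativeRing)
open import Algebra.Bundles using (CommutativeRing; Ring)
open import Algebra.Definitions.RawMonoid using (sum)
open import Algebra.Module.Bundles using (LeftModule)
open import Algebra.Morphism.Structures using (module RingMorphisms)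
import Algebra.Apartness.Properties.HeytingCommutativeRing as HeytingProperties
import Algebra.Properties.CommutativeSemigroup as CommutativeSemigroupProperties
import Algebra.Properties.Ring as RingProperties
import Algebra.Properties.Semiring.Sum as Sum
import Algebra.Solver.Ring.NaturalCoefficients.Default as Solver
import Algebra.Module.Construct.TensorUnit as TensorUnit
open import Data.Fin.Base using (Fin; zero; suc; punchIn; punchOut; funToFin; finToFun; remQuot; combine; fromℕ<)
import Data.Fin.Properties as Fin
open import Data.Nat.Base as ℕ using (ℕ; zero; suc; _∸_; _^_; _≤_; _<_; _≥_; z<s; s≤s; NonZero)
open import Data.Nat.Primality using (prime⇒nonTrivial)
import Data.Nat.Properties as ℕₚ
open import Data.Product.Base using (Σ-syntax; ∃; ∃-syntax; _×_; _,_; proj₁; proj₂; uncurry)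
open import Data.Vec.Functional using (Vector; transpose)
open import Data.Vec.Functional.Relation.Binary.Equality.Setoid using (≋-setoid)
open import Function.Base using (_∘_)
open import Function.Bundles using (Inverse)
open import Function.Definitions using (Injective)
open import Relation.Binary.Bundles using (Setoid)
open import Relation.Binary.Definitions using (Decidable)
open import Relation.Binary.PropositionalEquality as ≡ using (_≡_)
import Relation.Binary.Reasoning.Setoid as ≈-Reasoning
open import Relation.Nullary.Decidable using (Dec; yes; no; map′; decidable-stable)
open import Relation.Nullary.Negation using (¬_; contradiction)
open import Relation.Unary using (Pred; _∈_; _⊆_; _≐_)
open import Relation.Unary.Properties using (≐-sym; ≐-trans)

-- Counting in finite setoids.

module FiniteSetoid {a ℓ} {S : Setoid a ℓ} {M : ℕ} (card : HasCardinality S M) where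
  open Setoid S
  open Inverse card using (to; from; to-cong; from-cong; strictlyInverseˡ; strictlyInverseʳ)

  to-injective : ∀ {s t} → to s ≡ to t → s ≈ t
  to-injective {s} {t} eq =
    trans (sym (strictlyInverseʳ s)) (trans (from-cong eq) (strictlyInverseʳ t))

  from-injective : ∀ {i j} → from i ≈ from j → i ≡ j
  from-injective {i} {j} eq =
    ≡.trans (≡.sym (strictlyInverseˡ i)) (≡.trans (to-cong eq) (strictlyInverseˡ j))

  -- The equality of a Heyting field carries no decision procedure of its own; comparing indices in
  -- `Fin M` supplies the case distinctions used below.
  _≟_ : Decidable _≈_
  s ≟ t = map′ to-injective to-cong (to s Fin.≟ to t)

  pigeonhole : ∀ {M′} → M′ < M → (f : Carrier → Fin M′) → ∃[ s ] ∃[ t ] ¬ (s ≈ t) × f s ≡ f t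
  pigeonhole M′<M f with Fin.pigeonhole M′<M (f ∘ from)
  ... | i , j , i<j , eq = from i , from j , (λ e → Fin.<⇒≢ i<j (from-injective e)) , eq

  -- If `s` were missed, deleting its index from `Fin M` with `punchOut` would leave an injection of
  -- `Fin M′` into a set of `M ∸ 1` elements, so `M′ < M`.
  injective⇒surjective : ∀ {M′} → M ≤ M′ → {f : Fin M′ → Carrier} → Injective _≡_ _≈_ f →
                         ∀ s → ∃[ k ] f k ≈ s
  injective⇒surjective M≤M′ {f} inj s with Fin.any? (λ k → f k ≟ s)
  ... | yes hit = hit
  ... | no miss = contradiction M≤M′ (ℕₚ.<⇒≱ (avoiding (to ∘ f) (inj ∘ to-injective) (to s)
                    (λ k eq → miss (k , sym (to-injective eq)))))
    where
    avoiding : ∀ {M M′} (g : Fin M′ → Fin M) → Injective _≡_ _≡_ g →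
               (t : Fin M) → (∀ k → ¬ (t ≡ g k)) → M′ < M
    avoiding {suc M} g g-inj t t∉g =
      s≤s (Fin.injective⇒≤ {f = λ k → punchOut (t∉g k)}
        (λ {i} {j} eq → g-inj (Fin.punchOut-injective (t∉g i) (t∉g j) eq)))

  -- Taken at zero in the small field, this lists the `q ∸ 1` nonzero scalars. The element `s`
  -- itself shows that `M` is positive, so `M ∸ 1` is a true predecessor.
  others : ∀ s → Σ[ f ∈ (Fin (M ∸ 1) → Carrier) ] (∀ i → ¬ (f i ≈ s)) × Injective _≡_ _≈_ f
  others s = from ∘ proj₁ rest
           , (λ i eq → proj₁ (proj₂ rest) i
                (≡.trans (≡.sym (strictlyInverseˡ _)) (to-cong eq)))
           , (proj₂ (proj₂ rest) ∘ from-injective)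
    where
    except : ∀ {M} (t : Fin M) →
             Σ[ f ∈ (Fin (M ∸ 1) → Fin M) ] (∀ i → ¬ (f i ≡ t)) × Injective _≡_ _≡_ f
    except {suc M} t = punchIn t , Fin.punchInᵢ≢i t , Fin.punchIn-injective t _ _
    rest = except (to s)

HasCardinality-^ : ∀ {a ℓ M} {S : Setoid a ℓ} → HasCardinality S M →
                   ∀ n → HasCardinality (≋-setoid S n) (M ^ n)
HasCardinality-^ {M = M} {S} card n = record
  { to        = λ v → funToFin (to ∘ v)
  ; from      = λ k → from ∘ finToFun k
  ; to-cong   = λ v≈w → funToFin-cong (λ i → to-cong (v≈w i))
  ; from-cong = λ { ≡.refl i → refl }
  ; inverse   = (λ {k} v≈ → ≡.trans (funToFin-cong (λ i → inverseˡ (v≈ i))) (Fin.funToFin-finToFin {n} {M} k))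
              , (λ { {v} ≡.refl i → trans (from-cong (Fin.finToFun-funToFin (to ∘ v) i)) (strictlyInverseʳ (v i)) })
  }
  where
  open Setoid S
  open Inverse card
  funToFin-cong : ∀ {k} {f g : Fin k → Fin M} → (∀ i → f i ≡ g i) → funToFin f ≡ funToFin g
  funToFin-cong {zero}  f≗g = ≡.refl
  funToFin-cong {suc k} f≗g = ≡.cong₂ combine (f≗g zero) (funToFin-cong (f≗g ∘ suc))

-- Coordinatewise sums and one-dimensional subspaces.

module _ {r ℓr m ℓm} {R : Ring r ℓr} (M : LeftModule R m ℓm) where
  open Ring R using (_≈_; 1#) renaming (_*_ to _*ᴿ_)
  open LeftModule M
  open LinearAlgebra M

  -- Sums in `power M n` do not unfold coordinatewise when their length is a variable; this
  -- induction is what turns the entries of `lincomb` into dot products.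
  sum-power : ∀ {n d} (w : Vector (Vector Carrierᴹ n) d) i →
              sum (LeftModule.+ᴹ-rawMonoid (power M n)) w i ≡ sum +ᴹ-rawMonoid (λ j → w j i)
  sum-power {d = zero}  w i = ≡.refl
  sum-power {d = suc d} w i = ≡.cong (w zero i +ᴹ_) (sum-power (w ∘ suc) i)

  Span₁-⊆ : ∀ {s x y} → x ≈ᴹ s *ₗ y → Span {1} (λ _ → x) ⊆ Span {1} (λ _ → y)
  Span₁-⊆ {s} x≈sy (a , z≈ax) = (λ _ → a zero *ᴿ s) ,
    ≈ᴹ-trans z≈ax (+ᴹ-congʳ (≈ᴹ-trans (*ₗ-congˡ x≈sy) (≈ᴹ-sym (*ₗ-assoc (a zero) s _))))

  SameLine-*ₗ : ∀ {s t x y} → t *ᴿ s ≈ 1# → x ≈ᴹ s *ₗ y → SameLine x y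
  SameLine-*ₗ {s} {t} {x} {y} ts≈1 x≈sy = Span₁-⊆ x≈sy , Span₁-⊆ y≈tx
    where
    y≈tx : y ≈ᴹ t *ₗ x
    y≈tx = ≈ᴹ-sym (≈ᴹ-trans (*ₗ-congˡ x≈sy) (≈ᴹ-trans (≈ᴹ-sym (*ₗ-assoc t s y))
             (≈ᴹ-trans (*ₗ-congʳ ts≈1) (*ₗ-identityˡ y))))

-- Dot products, parallel vectors and the cross product over a commutative ring.

module DotProduct {r ℓr} (R : CommutativeRing r ℓr) where
  open CommutativeRing R hiding (zero)
  open Sum semiring
  open RingProperties ring using (+-cancelʳ; [y-z]x≈yx-zx; x∙y⁻¹≈ε⇒x≈y)
  open ≈-Reasoning setoid

  infix 7 _·_
  _·_ : ∀ {n} → Vector Carrier n → Vector Carrier n → Carrier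
  _·_ {n} u v = ∑[ i < n ] (u i * v i)

  ·-cong : ∀ {n} {u u′ v v′ : Vector Carrier n} →
           (∀ i → u i ≈ u′ i) → (∀ i → v i ≈ v′ i) → u · v ≈ u′ · v′
  ·-cong p q = sum-cong-≋ (λ i → *-cong (p i) (q i))

  ·-congˡ : ∀ {n} {u v v′ : Vector Carrier n} → (∀ i → v i ≈ v′ i) → u · v ≈ u · v′
  ·-congˡ = ·-cong (λ _ → refl)

  ·-congʳ : ∀ {n} {u u′ v : Vector Carrier n} → (∀ i → u i ≈ u′ i) → u · v ≈ u′ · v
  ·-congʳ p = ·-cong p (λ _ → refl)

  ·-comm : ∀ {n} (u v : Vector Carrier n) → u · v ≈ v · u
  ·-comm u v = sum-cong-≋ (λ i → *-comm (u i) (v i))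

  ·-zeroʳ : ∀ {n} (u : Vector Carrier n) {v} → (∀ i → v i ≈ 0#) → u · v ≈ 0#
  ·-zeroʳ {n} u v≈0 = trans (sum-cong-≋ (λ i → trans (*-congˡ (v≈0 i)) (zeroʳ (u i)))) (sum-replicate-zero n)

  ·-distribʳ-+ : ∀ {n} (u v w : Vector Carrier n) → (λ i → v i + w i) · u ≈ v · u + w · u
  ·-distribʳ-+ u v w = trans (sum-cong-≋ (λ i → distribʳ (u i) (v i) (w i)))
                             (∑-distrib-+ (λ i → v i * u i) (λ i → w i * u i))

  ·-*-assoc : ∀ {n} a (u v : Vector Carrier n) → (λ i → a * u i) · v ≈ a * (u · v)
  ·-*-assoc a u v = trans (sum-cong-≋ (λ i → *-assoc a (u i) (v i))) (sym (*-distribˡ-sum a (λ i → u i * v i)))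

  -- The two summations are exchanged. With `b` as the rows of a matrix B this is the adjunction
  -- u·(aB) = a·(Bu), which later serves both supports and codewords.
  ·-transpose : ∀ {n d} (u : Vector Carrier n) (a : Vector Carrier d) (b : Vector (Vector Carrier n) d) →
                u · (λ i → a · (λ j → b j i)) ≈ a · (λ j → u · b j)
  ·-transpose {n} {d} u a b = begin
    ∑[ i < n ] (u i * ∑[ j < d ] (a j * b j i))   ≈⟨ sum-cong-≋ (λ i → *-distribˡ-sum (u i) (λ j → a j * b j i)) ⟩
    ∑[ i < n ] ∑[ j < d ] (u i * (a j * b j i))   ≈⟨ ∑-comm (λ i j → u i * (a j * b j i)) ⟩
    ∑[ j < d ] ∑[ i < n ] (u i * (a j * b j i))   ≈⟨ sum-cong-≋ (λ j → sum-cong-≋ (λ i → swap (u i) (a j) (b j i))) ⟩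
    ∑[ j < d ] ∑[ i < n ] (a j * (u i * b j i))   ≈⟨ sum-cong-≋ (λ j → sym (*-distribˡ-sum (a j) (λ i → u i * b j i))) ⟩
    ∑[ j < d ] (a j * ∑[ i < n ] (u i * b j i))   ∎
    where
    swap : ∀ x y z → x * (y * z) ≈ y * (x * z)
    swap x y z = trans (sym (*-assoc x y z)) (trans (*-congʳ (*-comm x y)) (*-assoc y x z))

  unit : ∀ {n} → Fin n → Vector Carrier n
  unit zero    zero    = 1#
  unit zero    (suc _) = 0#
  unit (suc i) zero    = 0#
  unit (suc i) (suc j) = unit i j

  unit-· : ∀ {n} (i : Fin n) v → unit i · v ≈ v i
  unit-· zero    v = trans
    (+-cong (*-identityˡ (v zero)) (trans (·-comm (λ _ → 0#) (v ∘ suc)) (·-zeroʳ (v ∘ suc) (λ _ → refl))))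
    (+-identityʳ (v zero))
  unit-· (suc i) v = trans (+-cong (zeroˡ (v zero)) (unit-· i (v ∘ suc))) (+-identityˡ (v (suc i)))

  -- Vanishing of all 2 by 2 minors: a division-free form of proportionality, in which the zero
  -- vector is parallel to everything.
  Parallel : ∀ {n} → Vector Carrier n → Vector Carrier n → Set ℓr
  Parallel u v = ∀ i j → u i * v j ≈ u j * v i

  _×₃_ : Vector Carrier 3 → Vector Carrier 3 → Vector Carrier 3
  (u ×₃ v) zero             = u (suc zero) * v (suc (suc zero)) - u (suc (suc zero)) * v (suc zero)
  (u ×₃ v) (suc zero)       = u (suc (suc zero)) * v zero - u zero * v (suc (suc zero))
  (u ×₃ v) (suc (suc zero)) = u zero * v (suc zero) - u (suc zero) * v zero

  -- The semiring solver works without subtraction, so an identity is first proved with its negative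
  -- terms moved across; this moves them back.
  p+s≈r+q⇒p-q≈r-s : ∀ {p q r s} → p + s ≈ r + q → p - q ≈ r - s
  p+s≈r+q⇒p-q≈r-s {p} {q} {r} {s} p+s≈r+q = begin
    p - q              ≈⟨ x+y-y≈x (p - q) s ⟨
    p - q + s - s      ≈⟨ +-congʳ (xy∙z≈xz∙y p (- q) s) ⟩
    p + s - q - s      ≈⟨ +-congʳ (+-congʳ p+s≈r+q) ⟩
    r + q - q - s      ≈⟨ +-congʳ (x+y-y≈x r q) ⟩
    r - s              ∎
    where
    open CommutativeSemigroupProperties +-commutativeSemigroup using (xy∙z≈xz∙y)
    x+y-y≈x : ∀ x y → x + y - y ≈ x
    x+y-y≈x x y = trans (+-assoc x y (- y)) (trans (+-congˡ (-‿inverseʳ y)) (+-identityʳ x))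

  -- In the projective plane the distinct lines u^⟂ and v^⟂ meet in the point `u ×₃ v`, on which
  -- every common solution `w` must lie. If the cross product vanishes, the conclusion is trivial.
  ×₃-parallel : ∀ u v w → u · w ≈ 0# → v · w ≈ 0# → Parallel (u ×₃ v) w
  ×₃-parallel u v w u⊥w v⊥w = λ
    { zero             zero             → refl
    ; zero             (suc zero)       → c₀w₁≈c₁w₀
    ; zero             (suc (suc zero)) → sym c₂w₀≈c₀w₂
    ; (suc zero)       zero             → sym c₀w₁≈c₁w₀
    ; (suc zero)       (suc zero)       → refl
    ; (suc zero)       (suc (suc zero)) → c₁w₂≈c₂w₁
    ; (suc (suc zero)) zero             → c₂w₀≈c₀w₂
    ; (suc (suc zero)) (suc zero)       → sym c₁w₂≈c₂w₁
    ; (suc (suc zero)) (suc (suc zero)) → refl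
    }
    where
    open Solver commutativeSemiring

    -- Both sides of the identity inside are moved so that no subtraction
    -- occurs, and agree after adding a₂ b₂ w₂, by a·w = b·w = 0.
    minor : ∀ a₀ a₁ a₂ b₀ b₁ b₂ w₀ w₁ w₂ →
            a₀ * w₀ + (a₁ * w₁ + (a₂ * w₂ + 0#)) ≈ 0# →
            b₀ * w₀ + (b₁ * w₁ + (b₂ * w₂ + 0#)) ≈ 0# →
            (a₁ * b₂ - a₂ * b₁) * w₁ ≈ (a₂ * b₀ - a₀ * b₂) * w₀
    minor a₀ a₁ a₂ b₀ b₁ b₂ w₀ w₁ w₂ a·w≈0 b·w≈0 = begin
      (a₁ * b₂ - a₂ * b₁) * w₁           ≈⟨ [y-z]x≈yx-zx w₁ (a₁ * b₂) (a₂ * b₁) ⟩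
      a₁ * b₂ * w₁ - a₂ * b₁ * w₁        ≈⟨ p+s≈r+q⇒p-q≈r-s (+-cancelʳ (a₂ * b₂ * w₂) _ _ balanced) ⟩
      a₂ * b₀ * w₀ - a₀ * b₂ * w₀        ≈⟨ [y-z]x≈yx-zx w₀ (a₂ * b₀) (a₀ * b₂) ⟨
      (a₂ * b₀ - a₀ * b₂) * w₀           ∎
      where
      balanced : a₁ * b₂ * w₁ + a₀ * b₂ * w₀ + a₂ * b₂ * w₂ ≈ a₂ * b₀ * w₀ + a₂ * b₁ * w₁ + a₂ * b₂ * w₂
      balanced = begin
        a₁ * b₂ * w₁ + a₀ * b₂ * w₀ + a₂ * b₂ * w₂
          ≈⟨ solve 7 (λ a₀ a₁ a₂ b₂ w₀ w₁ w₂ →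
               a₁ :* b₂ :* w₁ :+ a₀ :* b₂ :* w₀ :+ a₂ :* b₂ :* w₂ :=
               b₂ :* (a₀ :* w₀ :+ (a₁ :* w₁ :+ (a₂ :* w₂ :+ con 0)))) refl a₀ a₁ a₂ b₂ w₀ w₁ w₂ ⟩
        b₂ * (a₀ * w₀ + (a₁ * w₁ + (a₂ * w₂ + 0#)))   ≈⟨ trans (*-congˡ a·w≈0) (zeroʳ b₂) ⟩
        0#                                            ≈⟨ trans (*-congˡ b·w≈0) (zeroʳ a₂) ⟨
        a₂ * (b₀ * w₀ + (b₁ * w₁ + (b₂ * w₂ + 0#)))
          ≈⟨ solve 7 (λ a₂ b₀ b₁ b₂ w₀ w₁ w₂ →
               a₂ :* (b₀ :* w₀ :+ (b₁ :* w₁ :+ (b₂ :* w₂ :+ con 0))) :=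
               a₂ :* b₀ :* w₀ :+ a₂ :* b₁ :* w₁ :+ a₂ :* b₂ :* w₂) refl a₂ b₀ b₁ b₂ w₀ w₁ w₂ ⟩
        a₂ * b₀ * w₀ + a₂ * b₁ * w₁ + a₂ * b₂ * w₂    ∎

    rotate : ∀ {x y z} → x + (y + (z + 0#)) ≈ 0# → y + (z + (x + 0#)) ≈ 0#
    rotate {x} {y} {z} eq = trans
      (solve 3 (λ x y z → y :+ (z :+ (x :+ con 0)) := x :+ (y :+ (z :+ con 0))) refl x y z) eq

    u₀ = u zero
    u₁ = u (suc zero)
    u₂ = u (suc (suc zero))
    v₀ = v zero
    v₁ = v (suc zero)
    v₂ = v (suc (suc zero))
    w₀ = w zero
    w₁ = w (suc zero)
    w₂ = w (suc (suc zero))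

    -- One minor gives all three, by cyclic shifts of the coordinates.
    c₀w₁≈c₁w₀ = minor u₀ u₁ u₂ v₀ v₁ v₂ w₀ w₁ w₂ u⊥w v⊥w
    c₁w₂≈c₂w₁ = minor u₁ u₂ u₀ v₁ v₂ v₀ w₁ w₂ w₀ (rotate u⊥w) (rotate v⊥w)
    c₂w₀≈c₀w₂ = minor u₂ u₀ u₁ v₂ v₀ v₁ w₂ w₀ w₁ (rotate (rotate u⊥w)) (rotate (rotate v⊥w))

  -- Up to sign, the coordinates of the cross product are the 2 by 2 minors.
  ×₃-zero⇒parallel : ∀ u v → (∀ i → (u ×₃ v) i ≈ 0#) → Parallel u v
  ×₃-zero⇒parallel u v u×v≈0 = λ
    { zero             zero             → refl
    ; zero             (suc zero)       → difference-zero (u×v≈0 (suc (suc zero)))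
    ; zero             (suc (suc zero)) → sym (difference-zero (u×v≈0 (suc zero)))
    ; (suc zero)       zero             → sym (difference-zero (u×v≈0 (suc (suc zero))))
    ; (suc zero)       (suc zero)       → refl
    ; (suc zero)       (suc (suc zero)) → difference-zero (u×v≈0 zero)
    ; (suc (suc zero)) zero             → difference-zero (u×v≈0 (suc zero))
    ; (suc (suc zero)) (suc zero)       → sym (difference-zero (u×v≈0 zero))
    ; (suc (suc zero)) (suc (suc zero)) → refl
    }
    where
    difference-zero : ∀ {x y} → x - y ≈ 0# → x ≈ y
    difference-zero {x} {y} = x∙y⁻¹≈ε⇒x≈y x y

-- Finite fields: inverses and proportionality.

module FiniteField {f ℓ ℓ#} (F : HeytingField f ℓ ℓ#) {M : ℕ}
                   (card : HasCardinality (Ring.setoid (fieldRing F)) M) where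
  open HeytingField F using (tight; #⇒invertible; heytingCommutativeRing)
  open HeytingProperties heytingCommutativeRing using (x-0≈x)
  open CommutativeRing (HeytingCommutativeRing.commutativeRing heytingCommutativeRing) public hiding (zero)
  open DotProduct (HeytingCommutativeRing.commutativeRing heytingCommutativeRing) public
  open FiniteSetoid card public using (_≟_)
  open Inverse card using (to; from; strictlyInverseʳ)
  open ≈-Reasoning setoid

  -- An inverse can be searched for among finitely many elements. If the search fails, `x` is not
  -- apart from 0, since apartness would yield an inverse, and tightness then makes `x` zero.
  inverse : ∀ {x} → ¬ (x ≈ 0#) → ∃[ y ] y * x ≈ 1#
  inverse {x} x≉0 with Fin.any? (λ k → (from k * x) ≟ 1#)
  ... | yes (k , eq) = from k , eq
  ... | no none = contradiction (proj₁ (tight x 0#) ¬x#0) x≉0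
    where
    ¬x#0 : ¬ (HeytingField._#_ F x 0#)
    ¬x#0 x#0 with #⇒invertible x#0
    ... | y , y[x-0]≈1 , _ = none (to y , trans (*-congʳ (strictlyInverseʳ y))
                                    (trans (*-congˡ (sym (x-0≈x x))) y[x-0]≈1))

  *-cancelˡ-nonzero : ∀ {x y z} → ¬ (x ≈ 0#) → x * y ≈ x * z → y ≈ z
  *-cancelˡ-nonzero {x} {y} {z} x≉0 xy≈xz with inverse x≉0
  ... | t , tx≈1 = begin
    y            ≈⟨ *-identityˡ y ⟨
    1# * y       ≈⟨ *-congʳ tx≈1 ⟨
    t * x * y    ≈⟨ *-assoc t x y ⟩
    t * (x * y)  ≈⟨ *-congˡ xy≈xz ⟩
    t * (x * z)  ≈⟨ *-assoc t x z ⟨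
    t * x * z    ≈⟨ *-congʳ tx≈1 ⟩
    1# * z       ≈⟨ *-identityˡ z ⟩
    z            ∎

  -- The factor is forced by coordinate `i`: it is `v i` divided by `u i`.
  parallel⇒multiple : ∀ {n} {u v : Vector Carrier n} {i} → ¬ (u i ≈ 0#) → Parallel u v →
                      ∃[ s ] ∀ j → v j ≈ s * u j
  parallel⇒multiple {u = u} {v} {i} uᵢ≉0 u∥v with inverse uᵢ≉0
  ... | t , tuᵢ≈1 = t * v i , λ j → begin
    v j                  ≈⟨ *-identityˡ (v j) ⟨
    1# * v j             ≈⟨ *-congʳ tuᵢ≈1 ⟨
    t * u i * v j        ≈⟨ *-assoc t (u i) (v j) ⟩
    t * (u i * v j)      ≈⟨ *-congˡ (trans (u∥v i j) (*-comm (u j) (v i))) ⟩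
    t * (v i * u j)      ≈⟨ *-assoc t (v i) (u j) ⟨
    t * v i * u j        ∎

  nonzero-entry : ∀ {n} {u : Vector Carrier n} → ¬ (∀ i → u i ≈ 0#) → ∃[ i ] ¬ (u i ≈ 0#)
  nonzero-entry {n} {u} = Fin.¬∀⟶∃¬ n (λ i → u i ≈ 0#) (λ i → u i ≟ 0#)

-- Vectors over the small field paired with vectors over the extension.

module _ {c ℓ ℓ# c′ ℓ′ ℓ#′ : Level} {q m : ℕ}
         (E : FiniteFieldExtension c ℓ ℓ# c′ ℓ′ ℓ#′ q m) where
  open FiniteFieldExtension E
  open RankMetric E
  private
    module 𝕂 = FiniteField 𝔽q K-cardinality
    module 𝕃 = FiniteField 𝔽qᵐ L-cardinality
  open RingMorphisms.IsRingMonomorphism ι-mono using (⟦⟧-cong; +-homo; *-homo; 0#-homo; 1#-homo)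
    renaming (injective to ι-injective)

  Kvec : ℕ → Set c
  Kvec n = Vector 𝕂.Carrier n

  infix 4 _≈ᴷ_ _≈ᴸ_ _⟂_
  _≈ᴷ_ : ∀ {n} → Kvec n → Kvec n → Set ℓ
  _≈ᴷ_ {n} = LeftModule._≈ᴹ_ (K^ n)

  _≈ᴸ_ : ∀ {n} → Lvec n → Lvec n → Set ℓ′
  _≈ᴸ_ {n} = LeftModule._≈ᴹ_ (L^ n)

  0ᴷ : ∀ {n} → Kvec n
  0ᴷ _ = 𝕂.0#

  0ᴸ : ∀ {n} → Lvec n
  0ᴸ _ = 𝕃.0#

  _⟂_ : ∀ {n} → Kvec n → Lvec n → Set ℓ′
  y ⟂ v = (ι ∘ y) 𝕃.· v 𝕃.≈ 𝕃.0#

  ι-zero : ∀ {x} → x 𝕂.≈ 𝕂.0# → ι x 𝕃.≈ 𝕃.0#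
  ι-zero x≈0 = 𝕃.trans (⟦⟧-cong x≈0) 0#-homo

  ι-nonzero : ∀ {x} → ¬ (x 𝕂.≈ 𝕂.0#) → ¬ (ι x 𝕃.≈ 𝕃.0#)
  ι-nonzero x≉0 ιx≈0 = x≉0 (ι-injective (𝕃.trans ιx≈0 (𝕃.sym 0#-homo)))

  ι-· : ∀ {n} (x y : Kvec n) → ι (x 𝕂.· y) 𝕃.≈ (ι ∘ x) 𝕃.· (ι ∘ y)
  ι-· {zero}  x y = 0#-homo
  ι-· {suc n} x y = 𝕃.trans (+-homo _ _) (𝕃.+-cong (*-homo _ _) (ι-· (x ∘ suc) (y ∘ suc)))

  ι-unit : ∀ {n} (i j : Fin n) → ι (𝕂.unit i j) 𝕃.≈ 𝕃.unit i j
  ι-unit zero    zero    = 1#-homo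
  ι-unit zero    (suc _) = 0#-homo
  ι-unit (suc i) zero    = 0#-homo
  ι-unit (suc i) (suc j) = ι-unit i j

  unit-⟂ : ∀ {n} (i : Fin n) v → (ι ∘ 𝕂.unit i) 𝕃.· v 𝕃.≈ v i
  unit-⟂ i v = 𝕃.trans (𝕃.·-congʳ (ι-unit i)) (𝕃.unit-· i v)

  -- The proportionality factor cannot vanish, as `w` is nonzero, so it is invertible.
  parallel⇒sameLine : ∀ {k} {u w : Lvec k} {r} → ¬ (u r 𝕃.≈ 𝕃.0#) → 𝕃.Parallel u w →
                      ¬ (w ≈ᴸ 0ᴸ) → L^.SameLine k w u
  parallel⇒sameLine {k} {u} {w} u≉0 u∥w w≉0 = SameLine-*ₗ (L^ k) (proj₂ (𝕃.inverse s≉0)) w≈su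
    where
    s = proj₁ (𝕃.parallel⇒multiple u≉0 u∥w)
    w≈su = proj₂ (𝕃.parallel⇒multiple u≉0 u∥w)
    s≉0 : ¬ (s 𝕃.≈ 𝕃.0#)
    s≉0 s≈0 = w≉0 (λ r → 𝕃.trans (w≈su r) (𝕃.trans (𝕃.*-congʳ s≈0) (𝕃.zeroˡ (u r))))

  -- Rank supports and orthogonality.

  module Support (Γ : OrderedBasis) where
    open OrderedBasis Γ

    column : ∀ {n} → Lvec n → Fin m → Kvec n
    column v = transpose (expand Γ v)

    -- Each entry of `v` is expanded in `γ` and the sums are exchanged. The products of `y` with the
    -- columns of the expansion are thus the coordinates, in the basis `γ`, of the value of `y` on
    -- `v`.
    ·-expand : ∀ {n} (y : Kvec n) v →
               (ι ∘ y) 𝕃.· v 𝕃.≈ (λ j → ι (y 𝕂.· column v j)) 𝕃.· γ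
    ·-expand y v = begin
      (ι ∘ y) 𝕃.· v                                          ≈⟨ 𝕃.·-congˡ expansion ⟩
      (ι ∘ y) 𝕃.· (λ i → γ 𝕃.· (λ j → ι (column v j i)))     ≈⟨ 𝕃.·-transpose (ι ∘ y) γ (λ j i → ι (column v j i)) ⟩
      γ 𝕃.· (λ j → (ι ∘ y) 𝕃.· (ι ∘ column v j))             ≈⟨ 𝕃.·-congˡ (λ j → ι-· y (column v j)) ⟨
      γ 𝕃.· (λ j → ι (y 𝕂.· column v j))                     ≈⟨ 𝕃.·-comm γ _ ⟩
      (λ j → ι (y 𝕂.· column v j)) 𝕃.· γ                     ∎
      where
      open ≈-Reasoning 𝕃.setoid
      expansion : ∀ i → v i 𝕃.≈ γ 𝕃.· (λ j → ι (column v j i))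
      expansion i = 𝕃.trans (proj₂ (L/K.IsBasis.spanning isBasis {v i} _)) (𝕃.·-comm _ γ)

    ⟂⇒column : ∀ {n} (y : Kvec n) v → y ⟂ v → ∀ j → y 𝕂.· column v j 𝕂.≈ 𝕂.0#
    ⟂⇒column y v y⟂v =
      L/K.IsBasis.independent isBasis _ (𝕃.trans (𝕃.sym (·-expand y v)) y⟂v)

    ⟂⇒support : ∀ {n} (y : Kvec n) v → y ⟂ v → ∀ {x} → x ∈ rankSupport Γ v → y 𝕂.· x 𝕂.≈ 𝕂.0#
    ⟂⇒support y v y⟂v {x} (a , x≈) = begin
      y 𝕂.· x                                        ≈⟨ 𝕂.·-congˡ combination ⟩
      y 𝕂.· (λ i → a 𝕂.· (λ j → column v j i))       ≈⟨ 𝕂.·-transpose y a (column v) ⟩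
      a 𝕂.· (λ j → y 𝕂.· column v j)                 ≈⟨ 𝕂.·-zeroʳ a (⟂⇒column y v y⟂v) ⟩
      𝕂.0#                                           ∎
      where
      open ≈-Reasoning 𝕂.setoid
      combination : ∀ i → x i 𝕂.≈ a 𝕂.· (λ j → column v j i)
      combination i = 𝕂.trans (x≈ i) (𝕂.reflexive
        (sum-power (TensorUnit.leftModule {R = K}) (λ j i → a j 𝕂.* column v j i) i))

    column∈support : ∀ {n} (v : Lvec n) j → column v j ∈ rankSupport Γ v
    column∈support v j = 𝕂.unit j , λ i → 𝕂.sym (𝕂.trans
      (𝕂.reflexive (sum-power (TensorUnit.leftModule {R = K}) (λ k i → 𝕂.unit j k 𝕂.* column v k i) i))
      (𝕂.unit-· j (λ k → column v k i)))

    -- The columns of `v′` lie in the support of `v`, so `y` annihilates each of them; by `·-expand`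
    -- these products are the coordinates of the value of `y` on `v′`.
    support-⊆⇒⟂ : ∀ {n} (v v′ : Lvec n) → rankSupport Γ v′ ⊆ rankSupport Γ v →
                  ∀ y → y ⟂ v → y ⟂ v′
    support-⊆⇒⟂ v v′ σ′⊆σ y y⟂v = 𝕃.trans (·-expand y v′)
      (𝕃.trans (𝕃.·-comm _ γ)
        (𝕃.·-zeroʳ γ (λ j → ι-zero (⟂⇒support y v y⟂v (σ′⊆σ (column∈support v′ j))))))

    -- Nondegeneracy writes the `i`-th standard basis vector as a sum of support vectors. Each
    -- summand is annihilated by `y`, hence so is the sum, and the product with it is `y i`.
    ⟂-nondegenerate : ∀ {n p} {C : Pred (Lvec n) p} → Nondegenerate Γ C →
                      ∀ y → (∀ v → v ∈ C → y ⟂ v) → y ≈ᴷ 0ᴷ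
    ⟂-nondegenerate {n} nondeg y y⟂C i =
      𝕂.trans (𝕂.sym (𝕂.unit-· i y)) (𝕂.trans (𝕂.·-comm (𝕂.unit i) y) (annihilates (nondeg (𝕂.unit i))))
      where
      open LeftModule (K^ n) using (+ᴹ-rawMonoid)
      annihilates-sum : ∀ {d} (w : Vector (Kvec n) d) → (∀ j → y 𝕂.· w j 𝕂.≈ 𝕂.0#) →
                        sum +ᴹ-rawMonoid w 𝕂.· y 𝕂.≈ 𝕂.0#
      annihilates-sum {zero}  w y·w≈0 = 𝕂.trans (𝕂.·-comm _ y) (𝕂.·-zeroʳ y (λ _ → 𝕂.refl))
      annihilates-sum {suc d} w y·w≈0 = 𝕂.trans (𝕂.·-distribʳ-+ y (w zero) _)
        (𝕂.trans (𝕂.+-cong (𝕂.trans (𝕂.·-comm _ y) (y·w≈0 zero)) (annihilates-sum (w ∘ suc) (y·w≈0 ∘ suc)))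
          (𝕂.+-identityˡ 𝕂.0#))
      annihilates : ∀ {x} → x ∈ K^.SumOfSubspaces n {I = ∃ _} (λ v → rankSupport Γ (proj₁ v)) → y 𝕂.· x 𝕂.≈ 𝕂.0#
      annihilates {x} (d , w , w∈σ , x≈Σw) = 𝕂.trans (𝕂.·-congˡ x≈Σw) (𝕂.trans (𝕂.·-comm y _)
        (annihilates-sum w (λ j → ⟂⇒support y _ (y⟂C _ (proj₂ (proj₁ (w∈σ j)))) (proj₂ (w∈σ j)))))

  -- Pigeonhole for the map y ↦ (Σ ι(yⱼ) vⱼ , yᵢ), as q^m · q < q^n.
  orthogonal-vanishing-at : ∀ {n} → 1 < q → m ℕ.+ 2 ≤ n → (v : Lvec n) (i : Fin n) →
                    Σ[ y ∈ Kvec n ] ¬ (y ≈ᴷ 0ᴷ) × y ⟂ v × y i 𝕂.≈ 𝕂.0#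
  orthogonal-vanishing-at {n} 1<q m+2≤n v i = difference (pigeonhole fewer signature)
    where
    open FiniteSetoid (HasCardinality-^ K-cardinality n) using (pigeonhole)
    module IK = Inverse K-cardinality
    module IL = Inverse L-cardinality

    fewer : q ^ m ℕ.* q < q ^ n
    fewer = begin-strict
      q ^ m ℕ.* q   ≡⟨ ℕₚ.*-comm (q ^ m) q ⟩
      q ^ suc m     <⟨ ℕₚ.^-monoʳ-< q 1<q (ℕₚ.≤-trans (ℕₚ.≤-reflexive (ℕₚ.+-comm 2 m)) m+2≤n) ⟩
      q ^ n         ∎
      where open ℕₚ.≤-Reasoning

    signature : Kvec n → Fin (q ^ m ℕ.* q)
    signature y = combine (IL.to ((ι ∘ y) 𝕃.· v)) (IK.to (y i))

    difference : ∃[ y ] ∃[ z ] ¬ (y ≈ᴷ z) × signature y ≡ signature z →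
                 Σ[ y ∈ Kvec n ] ¬ (y ≈ᴷ 0ᴷ) × y ⟂ v × y i 𝕂.≈ 𝕂.0#
    difference (y , z , y≉z , eq) =
        (λ j → y j 𝕂.- z j)
      , (λ y-z≈0 → y≉z (λ j → 𝕂P.x∙y⁻¹≈ε⇒x≈y (y j) (z j) (y-z≈0 j)))
      -- Adding the value at `z` to both sides reduces orthogonality to the additivity of `ι`.
      , 𝕃P.+-cancelʳ ((ι ∘ z) 𝕃.· v) _ _ [y-z]·v+z·v≈0+z·v
      , 𝕂.trans (𝕂.+-congʳ (FiniteSetoid.to-injective K-cardinality (proj₂ eqs))) (𝕂.-‿inverseʳ (z i))
      where
      module 𝕂P = RingProperties 𝕂.ring
      module 𝕃P = RingProperties 𝕃.ring
      eqs = Fin.combine-injective (IL.to ((ι ∘ y) 𝕃.· v)) (IK.to (y i)) (IL.to ((ι ∘ z) 𝕃.· v)) (IK.to (z i)) eq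
      open ≈-Reasoning 𝕃.setoid
      y-z+z≈y : ∀ j → ι (y j 𝕂.- z j) 𝕃.+ ι (z j) 𝕃.≈ ι (y j)
      y-z+z≈y j = 𝕃.trans (𝕃.sym (+-homo _ _)) (⟦⟧-cong (𝕂.trans (𝕂.+-assoc _ _ _)
        (𝕂.trans (𝕂.+-congˡ (𝕂.-‿inverseˡ (z j))) (𝕂.+-identityʳ (y j)))))
      [y-z]·v+z·v≈0+z·v : (λ j → ι (y j 𝕂.- z j)) 𝕃.· v 𝕃.+ (ι ∘ z) 𝕃.· v 𝕃.≈ 𝕃.0# 𝕃.+ (ι ∘ z) 𝕃.· v
      [y-z]·v+z·v≈0+z·v = begin
        (λ j → ι (y j 𝕂.- z j)) 𝕃.· v 𝕃.+ (ι ∘ z) 𝕃.· v   ≈⟨ 𝕃.·-distribʳ-+ v _ (ι ∘ z) ⟨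
        (λ j → ι (y j 𝕂.- z j) 𝕃.+ ι (z j)) 𝕃.· v          ≈⟨ 𝕃.·-congʳ y-z+z≈y ⟩
        (ι ∘ y) 𝕃.· v                                      ≈⟨ FiniteSetoid.to-injective L-cardinality (proj₁ eqs) ⟩
        (ι ∘ z) 𝕃.· v                                      ≈⟨ 𝕃.+-identityˡ _ ⟨
        𝕃.0# 𝕃.+ (ι ∘ z) 𝕃.· v                             ∎

  -- The system of a generator matrix, and scatteredness.

  module System {n k : ℕ} (G : Vector (Lvec n) k) where

    -- The map y ↦ Gy, linear over the small field; its image is the span of the columns of `G`,
    -- that is, the system.
    G· : Kvec n → Lvec k
    G· y r = (ι ∘ y) 𝕃.· G r

    G·≈lincomb : ∀ y r → L^/K.lincomb k y (transpose G) r 𝕃.≈ G· y r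
    G·≈lincomb y r = 𝕃.reflexive (sum-power (TensorUnit.leftModule {R = L}) (λ i r → ι (y i) 𝕃.* G r i) r)

    codeword : ∀ x {v} → v ≈ᴸ L^.lincomb n x G → ∀ i → v i 𝕃.≈ x 𝕃.· (λ r → G r i)
    codeword x v≈xG i = 𝕃.trans (v≈xG i)
      (𝕃.reflexive (sum-power (TensorUnit.leftModule {R = L}) (λ r i → x r 𝕃.* G r i) i))

    -- By associativity y·(xG) = x·(Gy), so `y` is orthogonal to the codeword xG exactly when Gy
    -- lies in the hyperplane x^⟂.
    ·-codeword : ∀ x {v} → v ≈ᴸ L^.lincomb n x G → ∀ y → (ι ∘ y) 𝕃.· v 𝕃.≈ x 𝕃.· G· y
    ·-codeword x v≈xG y = 𝕃.trans (𝕃.·-congˡ (codeword x v≈xG)) (𝕃.·-transpose (ι ∘ y) x G)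

    G·-scale : ∀ {y z : Kvec n} {a} → (∀ i → y i 𝕂.≈ a 𝕂.* z i) → ∀ r → G· y r 𝕃.≈ ι a 𝕃.* G· z r
    G·-scale {y} {z} {a} y≈az r = 𝕃.trans
      (𝕃.·-congʳ (λ i → 𝕃.trans (⟦⟧-cong (y≈az i)) (*-homo a (z i))))
      (𝕃.·-*-assoc (ι a) (ι ∘ z) (G r))

    -- |L_𝒰| = (q^n − 1)/(q − 1): the q − 1 nonzero multiples of one representative
    -- per point are distinct, so together with 0 they exhaust F_q^n.
    module _ {p} {𝒰 : Pred (Lvec k) p} (𝒰≐ : 𝒰 ≐ L^/K.Span k (transpose G))
             (G·-injective : ∀ y → G· y ≈ᴸ 0ᴸ → y ≈ᴷ 0ᴷ)
             (scattered : Scattered n 𝒰) where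

      private
        N = proj₁ scattered
        module P = Inverse (proj₂ (proj₂ scattered))

        scalars = FiniteSetoid.others K-cardinality 𝕂.0#

        scalar : Fin (q ∸ 1) → 𝕂.Carrier
        scalar = proj₁ scalars

        scalar≉0 : ∀ a → ¬ (scalar a 𝕂.≈ 𝕂.0#)
        scalar≉0 = proj₁ (proj₂ scalars)

      point : ∀ y → ¬ (y ≈ᴷ 0ᴷ) → Setoid.Carrier (linearSet 𝒰)
      point y y≉0 = G· y
                  , proj₂ 𝒰≐ (y , λ r → 𝕃.sym (G·≈lincomb y r))
                  , λ Gy≈0 → y≉0 (G·-injective y Gy≈0)

      -- Coordinates, with respect to the columns of `G`, of the vector that the enumeration of the
      -- linear set picks for its `j`-th point; membership in the span provides them.
      representative : Fin N → Kvec n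
      representative j = proj₁ (proj₁ 𝒰≐ (proj₁ (proj₂ (P.from j))))

      G·-representative : ∀ j → proj₁ (P.from j) ≈ᴸ G· (representative j)
      G·-representative j r = 𝕃.trans (proj₂ (proj₁ 𝒰≐ (proj₁ (proj₂ (P.from j)))) r)
                                (G·≈lincomb (representative j) r)

      representative≉0 : ∀ j → ¬ (representative j ≈ᴷ 0ᴷ)
      representative≉0 j y≈0 = proj₂ (proj₂ (P.from j)) (λ r →
        𝕃.trans (G·-representative j r)
          (𝕃.trans (𝕃.·-comm _ (G r)) (𝕃.·-zeroʳ (G r) (λ i → ι-zero (y≈0 i)))))

      -- A nonzero scalar stays invertible under `ι`, so `G· y` spans the `j`-th point. The index
      -- `j` can therefore be recovered from `y` alone.
      index-unique : ∀ {y} (y≉0 : ¬ (y ≈ᴷ 0ᴷ)) {a j} →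
                     (∀ i → y i 𝕂.≈ scalar a 𝕂.* representative j i) → P.to (point y y≉0) ≡ j
      index-unique {y} y≉0 {a} {j} y≈ = ≡.trans
        (P.to-cong (SameLine-*ₗ (L^ k) (proj₂ (𝕃.inverse (ι-nonzero (scalar≉0 a))))
          (λ r → 𝕃.trans (G·-scale y≈ r) (𝕃.*-congˡ (𝕃.sym (G·-representative j r))))))
        (P.strictlyInverseˡ j)

      multiple : Fin N × Fin (q ∸ 1) → Kvec n
      multiple (j , a) i = scalar a 𝕂.* representative j i

      multiple≉0 : ∀ ja → ¬ (multiple ja ≈ᴷ 0ᴷ)
      multiple≉0 (j , a) eq = representative≉0 j (λ i →
        𝕂.*-cancelˡ-nonzero (scalar≉0 a) (𝕂.trans (eq i) (𝕂.sym (𝕂.zeroʳ (scalar a)))))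

      -- The point of the vector recovers `j`; cancelling a nonzero entry of the common
      -- representative then recovers `a`.
      multiple-injective : Injective _≡_ _≈ᴷ_ multiple
      multiple-injective {j , a} {j′ , a′} eq with
        ≡.trans (≡.sym (index-unique (multiple≉0 (j , a)) (λ _ → 𝕂.refl))) (index-unique (multiple≉0 (j , a)) eq)
      ... | ≡.refl with 𝕂.nonzero-entry (representative≉0 j)
      ... | i , yᵢ≉0 = ≡.cong (j ,_) (proj₂ (proj₂ scalars)
        (𝕂.*-cancelˡ-nonzero yᵢ≉0 (𝕂.trans (𝕂.*-comm _ _) (𝕂.trans (eq i) (𝕂.*-comm _ _)))))

      enumerate : Fin (suc (N ℕ.* (q ∸ 1))) → Kvec n
      enumerate zero    = 0ᴷ
      enumerate (suc e) = multiple (remQuot {N} (q ∸ 1) e)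

      enumerate-injective : Injective _≡_ _≈ᴷ_ enumerate
      enumerate-injective {zero}  {zero}   eq = ≡.refl
      enumerate-injective {zero}  {suc e′} eq = contradiction (λ i → 𝕂.sym (eq i)) (multiple≉0 _)
      enumerate-injective {suc e} {zero}   eq = contradiction eq (multiple≉0 _)
      enumerate-injective {suc e} {suc e′} eq = ≡.cong suc (begin
        e                                            ≡⟨ Fin.combine-remQuot {N} (q ∸ 1) e ⟨
        uncurry combine (remQuot {N} (q ∸ 1) e)      ≡⟨ ≡.cong (uncurry combine) (multiple-injective eq) ⟩
        uncurry combine (remQuot {N} (q ∸ 1) e′)     ≡⟨ Fin.combine-remQuot {N} (q ∸ 1) e′ ⟩
        e′                                           ∎)
        where open ≡.≡-Reasoning

      -- An injective list at least as long as the whole space misses nothing, and its only entry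
      -- besides the multiples is the zero vector.
      nonzero⇒multiple : ∀ {y} → ¬ (y ≈ᴷ 0ᴷ) → ∃[ ja ] y ≈ᴷ multiple ja
      nonzero⇒multiple {y} y≉0 = unpack (injective⇒surjective enough enumerate-injective y)
        where
        open FiniteSetoid (HasCardinality-^ K-cardinality n) using (injective⇒surjective)
        enough : q ^ n ≤ suc (N ℕ.* (q ∸ 1))
        -- Truncation is harmless here, as m ≤ 1 + (m ∸ 1) for every m.
        enough = ≡.subst (λ e → q ^ n ≤ suc e) (≡.sym (proj₁ (proj₂ scattered))) (ℕₚ.m≤n+m∸n (q ^ n) 1)
        unpack : ∃[ e ] enumerate e ≈ᴷ y → ∃[ ja ] y ≈ᴷ multiple ja
        unpack (zero  , eq) = contradiction (λ i → 𝕂.sym (eq i)) y≉0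
        unpack (suc e , eq) = remQuot {N} (q ∸ 1) e , λ i → 𝕂.sym (eq i)

      -- This is scatteredness in the form that the system meets each of its points in dimension 1,
      -- recovered from the count. Equal points have equal indices, so `y` and `z` are multiples of
      -- one representative, and `t` is the quotient of the two scalars.
      sameLine⇒multiple : ∀ {y z} → ¬ (y ≈ᴷ 0ᴷ) → ¬ (z ≈ᴷ 0ᴷ) → L^.SameLine k (G· y) (G· z) →
                          ∃[ t ] ∀ i → y i 𝕂.≈ t 𝕂.* z i
      sameLine⇒multiple {y} {z} y≉0 z≉0 same with nonzero⇒multiple y≉0 | nonzero⇒multiple z≉0
      ... | (j , a) , y≈ | (j′ , b) , z≈ with
        ≡.trans (≡.sym (index-unique y≉0 y≈))
          (≡.trans (P.to-cong {point y y≉0} {point z z≉0} same) (index-unique z≉0 z≈))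
      ... | ≡.refl with 𝕂.inverse (scalar≉0 b)
      ... | b⁻¹ , b⁻¹b≈1 = scalar a 𝕂.* b⁻¹ , λ i → begin
        y i                                                        ≈⟨ y≈ i ⟩
        scalar a 𝕂.* representative j i                             ≈⟨ 𝕂.*-congˡ (𝕂.*-identityˡ _) ⟨
        scalar a 𝕂.* (𝕂.1# 𝕂.* representative j i)                  ≈⟨ 𝕂.*-congˡ (𝕂.*-congʳ b⁻¹b≈1) ⟨
        scalar a 𝕂.* (b⁻¹ 𝕂.* scalar b 𝕂.* representative j i)       ≈⟨ 𝕂.*-congˡ (𝕂.*-assoc _ _ _) ⟩
        scalar a 𝕂.* (b⁻¹ 𝕂.* (scalar b 𝕂.* representative j i))     ≈⟨ 𝕂.*-congˡ (𝕂.*-congˡ (z≈ i)) ⟨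
        scalar a 𝕂.* (b⁻¹ 𝕂.* z i)                                  ≈⟨ 𝕂.*-assoc _ _ _ ⟨
        scalar a 𝕂.* b⁻¹ 𝕂.* z i                                    ∎
        where open ≈-Reasoning 𝕂.setoid

  -- Minimality of codes of dimension 3.

  module _ {n p p′} (1<q : 1 < q) (Γ : OrderedBasis) {C : Pred (Lvec n) p}
           (nondegenerate : Nondegenerate Γ C) (m+2≤n : m ℕ.+ 2 ≤ n)
           {G : Vector (Lvec n) 3} (G-basis : IsGeneratorMatrix G C)
           {𝒰 : Pred (Lvec 3) p′} (𝒰≐ : 𝒰 ≐ L^/K.Span 3 (transpose G))
           (scattered : Scattered n 𝒰) where
    open Support Γ
    open System G
    open L^.IsBasis n G-basis using (spanning)

    -- By `·-codeword`, a vector in the kernel is orthogonal to every codeword, which nondegeneracy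
    -- allows only for zero.
    G·-injective : ∀ y → G· y ≈ᴸ 0ᴸ → y ≈ᴷ 0ᴷ
    G·-injective y Gy≈0 = ⟂-nondegenerate nondegenerate y (λ w w∈C →
      𝕃.trans (·-codeword (proj₁ (spanning w∈C)) (proj₂ (spanning w∈C)) y)
        (𝕃.·-zeroʳ (proj₁ (spanning w∈C)) Gy≈0))

    orthogonal : (v : Lvec n) (i : Fin n) → Σ[ y ∈ Kvec n ] ¬ (y ≈ᴷ 0ᴷ) × y ⟂ v × y i 𝕂.≈ 𝕂.0#
    orthogonal = orthogonal-vanishing-at 1<q m+2≤n

    -- An arbitrary coordinate, available because n ≥ 2; it serves to obtain a first nonzero vector
    -- orthogonal to `v`.
    i₀ : Fin n
    i₀ = fromℕ< (ℕₚ.<-≤-trans z<s (ℕₚ.≤-trans (ℕₚ.m≤n+m 2 m) m+2≤n))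

    -- y and z with zᵢ = 0 ≠ yᵢ are independent, although both map to the point u.
    not-all-parallel : ∀ {v} {u : Lvec 3} {r} → ¬ (u r 𝕃.≈ 𝕃.0#) →
                       ¬ (∀ y → y ⟂ v → 𝕃.Parallel u (G· y))
    not-all-parallel {v} {u} u≉0 parallel with orthogonal v i₀
    ... | y , y≉0 , y⟂v , _ with 𝕂.nonzero-entry y≉0
    ... | i , yᵢ≉0 with orthogonal v i
    ... | z , z≉0 , z⟂v , zᵢ≈0 = yᵢ≉0 (𝕂.trans (proj₂ y≈tz i) (𝕂.trans (𝕂.*-congˡ zᵢ≈0) (𝕂.zeroʳ _)))
      where
      line : ∀ y → ¬ (y ≈ᴷ 0ᴷ) → y ⟂ v → L^.SameLine 3 (G· y) u
      line y y≉0 y⟂v = parallel⇒sameLine u≉0 (parallel y y⟂v) (λ Gy≈0 → y≉0 (G·-injective y Gy≈0))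
      y≈tz : ∃[ t ] ∀ i → y i 𝕂.≈ t 𝕂.* z i
      y≈tz = sameLine⇒multiple 𝒰≐ G·-injective scattered y≉0 z≉0
        (≐-trans (line y y≉0 y⟂v) (≐-sym (line z z≉0 z⟂v)))

    minimal : Minimal Γ C
    minimal v v′ v∈C v′∈C σ′⊆σ = conclude (Fin.all? (λ r → x r 𝕃.≟ 𝕃.0#))
      where
      open LeftModule (L^ n) using (_≈ᴹ_; _*ₗ_)

      x x′ : Lvec 3
      x  = proj₁ (spanning v∈C)
      x′ = proj₁ (spanning v′∈C)

      v≈xG : v ≈ᴸ L^.lincomb n x G
      v≈xG = proj₂ (spanning v∈C)

      v′≈x′G : v′ ≈ᴸ L^.lincomb n x′ G
      v′≈x′G = proj₂ (spanning v′∈C)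

      ⟂-⊆ : ∀ y → y ⟂ v → y ⟂ v′
      ⟂-⊆ = support-⊆⇒⟂ v v′ σ′⊆σ

      G·∥x×x′ : ∀ y → y ⟂ v → 𝕃.Parallel (x 𝕃.×₃ x′) (G· y)
      G·∥x×x′ y y⟂v = 𝕃.×₃-parallel x x′ (G· y)
        (𝕃.trans (𝕃.sym (·-codeword x v≈xG y)) y⟂v)
        (𝕃.trans (𝕃.sym (·-codeword x′ v′≈x′G y)) (⟂-⊆ y y⟂v))

      x×x′≈0 : ∀ r → (x 𝕃.×₃ x′) r 𝕃.≈ 𝕃.0#
      -- A nonzero coordinate would make the cross product a genuine point carrying Gy for every `y`
      -- orthogonal to `v`. Decidable equality removes the double negation.
      x×x′≈0 r = decidable-stable ((x 𝕃.×₃ x′) r 𝕃.≟ 𝕃.0#) (λ c≉0 → not-all-parallel {r = r} c≉0 G·∥x×x′)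

      conclude : Dec (∀ r → x r 𝕃.≈ 𝕃.0#) → ∃[ α ] v′ ≈ᴹ α *ₗ v
      -- With `x` zero, parallelism says nothing about `x′`. Instead `v` is zero, so every standard
      -- basis vector is orthogonal to it, hence to `v′`, and all entries of `v′` vanish.
      conclude (yes x≈0) = 𝕃.0# , λ i → 𝕃.trans (v′≈0 i) (𝕃.sym (𝕃.zeroˡ (v i)))
        where
        v≈0 : ∀ i → v i 𝕃.≈ 𝕃.0#
        v≈0 i = 𝕃.trans (codeword x v≈xG i) (𝕃.trans (𝕃.·-comm x (λ r → G r i)) (𝕃.·-zeroʳ (λ r → G r i) x≈0))
        v′≈0 : ∀ i → v′ i 𝕃.≈ 𝕃.0#
        v′≈0 i = 𝕃.trans (𝕃.sym (unit-⟂ i v′)) (⟂-⊆ (𝕂.unit i) (𝕃.trans (unit-⟂ i v) (v≈0 i)))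
      conclude (no x≉0) = α , λ i → begin
        v′ i                                 ≈⟨ codeword x′ v′≈x′G i ⟩
        x′ 𝕃.· (λ r → G r i)                 ≈⟨ 𝕃.·-congʳ {v = λ r → G r i} x′≈αx ⟩
        (λ r → α 𝕃.* x r) 𝕃.· (λ r → G r i)  ≈⟨ 𝕃.·-*-assoc α x (λ r → G r i) ⟩
        α 𝕃.* (x 𝕃.· (λ r → G r i))          ≈⟨ 𝕃.*-congˡ (codeword x v≈xG i) ⟨
        α 𝕃.* v i                            ∎
        where
        open ≈-Reasoning 𝕃.setoid
        -- The vanishing cross product becomes proportionality once a nonzero entry of `x` is
        -- available as divisor.
        x′∝x : ∃[ α ] ∀ r → x′ r 𝕃.≈ α 𝕃.* x r
        x′∝x = 𝕃.parallel⇒multiple {u = x} {x′} (proj₂ (𝕃.nonzero-entry x≉0)) (𝕃.×₃-zero⇒parallel x x′ x×x′≈0)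
        α = proj₁ x′∝x
        x′≈αx = proj₂ x′∝x

-- Prime powers, and the theorem.

PrimePower⇒>1 : ∀ {q} → PrimePower q → 1 < q
PrimePower⇒>1 (p , e , p-prime , ≡.refl) =
  ℕₚ.≤-trans 1<p (ℕₚ.m≤m*n p (p ^ e) {{ℕₚ.m^n≢0 p e {{ℕ.>-nonZero (ℕₚ.<-trans z<s 1<p)}}}})
  where
  1<p : 1 < p
  1<p = ℕ.nonTrivial⇒n>1 p {{prime⇒nonTrivial p-prime}}

open import Data.Nat.Base using (_+_)

theorem6p3 : ∀ {c ℓ ℓ# c′ ℓ′ ℓ#′ p p′} {q m n : ℕ} → PrimePower q → .{{_ : NonZero m}} → .{{_ : NonZero n}} →
    (E : FiniteFieldExtension c ℓ ℓ# c′ ℓ′ ℓ#′ q m) → let open RankMetric E in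
    (Γ : OrderedBasis) →
    (C : Pred (Lvec n) p) → IsCode n 3 C → Nondegenerate Γ C → n ≥ m + 2 →
    (𝒰 : Pred (Lvec 3) p′) → IsSystem n 3 𝒰 → CorrespondsTo 𝒰 C →
    Scattered n 𝒰 → Minimal Γ C
theorem6p3 q-primePower E Γ C _ nondegenerate n≥m+2 𝒰 _ (G , G-basis , 𝒰≐) scattered =
  minimal E (PrimePower⇒>1 q-primePower) Γ nondegenerate n≥m+2 G-basis 𝒰≐ scattered
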